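{- Every edge-coloured graph $G$ satisfies $t_{\mathrm{inj}}(C_6^A,G)\leq (1/2)^6+o(1)$, where $o(1)$ denotes a quantity tending to $0$ as $v(G)\to\infty$; that is, for every $\varepsilon>0$ there exists $n_0$ such that every edge-coloured graph $G$ with $v(G)\geq n_0$ satisfies $t_{\mathrm{inj}}(C_6^A,G)\leq (1/2)^6+\varepsilon$.
   Context: An edge-coloured graph is a (finite, simple) graph each of whose edges is coloured either red or blue. The alternating $6$-cycle $C_6^A$ is the edge-coloured graph consisting of the cycle $C_6$ in which every vertex is incident to exactly one red edge and exactly one blue edge. A homomorphism from an edge-coloured graph $H$ to an edge-coloured graph $G$ is a map $f:V(H)\to V(G)$ such that whenever $uv$ is an edge of $H$, $f(u)f(v)$ is an edge of $G$ of the same colour as $uv$. For edge-coloured graphs $H,G$ with $v(G)\geq v(H)$, let $\hom_{\mathrm{inj}}(H,G)$ be the number of injective homomorphisms from $H$ to $G$, and set $\hom_{\mathrm{inj}}(H,G):=0$ if $v(G)<v(H)$. Define $t_{\mathrm{inj}}(H,G):=\frac{(v(G)-v(H))!}{v(G)!}\hom_{\mathrm{inj}}(H,G)$, i.e. the probability that a uniformly random injective map $V(H)\to V(G)$ is a homomorphism (and $0$ if $v(G)<v(H)$). -}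

module Defs where

open import Data.Nat using (ℕ; zero; suc; _*_; _∸_)
open import Data.Fin using (Fin; zero; suc)
open import Data.Fin using (#_)
import Data.Fin.Properties as FinP
open import Data.Maybe using (Maybe; just; nothing)
open import Data.Product using (_×_; _,_; Σ)
open import Data.List using (List; []; _∷_; _++_; map; concatMap; length; filter)
open import Data.List.Relation.Unary.All using (All; all?)
open import Data.Vec using (Vec; []; _∷_; lookup; toList)
open import Relation.Binary.PropositionalEquality using (_≡_; _≢_; refl)
open import Relation.Nullary using (Dec; yes; no)
open import Relation.Nullary.Decidable using (_×-dec_)
open import Data.Integer using (+_)
open import Data.Rational using (ℚ; _/_; 0ℚ)

data Colour : Set where
  red blue : Colour

_≟c_ : (a b : Colour) → Dec (a ≡ b)
red ≟c red = yes refl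
red ≟c blue = no λ ()
blue ≟c red = no λ ()
blue ≟c blue = yes refl

_≟m_ : (a b : Maybe Colour) → Dec (a ≡ b)
nothing ≟m nothing = yes refl
nothing ≟m just _ = no λ ()
just _ ≟m nothing = no λ ()
just a ≟m just b with a ≟c b
... | yes refl = yes refl
... | no ne = no λ { refl → ne refl }

-- A finite simple edge-coloured graph on vertex set Fin n:
-- col i j = nothing means no edge, just c means an edge of colour c.
-- Symmetric (undirected) and loopless.
record ECGraph (n : ℕ) : Set where
  field
    col   : Fin n → Fin n → Maybe Colour
    sym   : ∀ i j → col i j ≡ col j i
    loop  : ∀ i → col i i ≡ nothing
open ECGraph public

C6A-edges : List (Fin 6 × Fin 6 × Colour)
C6A-edges =
    (# 0 , # 1 , red) ∷ (# 1 , # 2 , blue) ∷ (# 2 , # 3 , red) ∷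
    (# 3 , # 4 , blue) ∷ (# 4 , # 5 , red) ∷ (# 5 , # 0 , blue) ∷ []

-- All maps Fin k → Fin n, represented as vectors (f(0), …, f(k-1)).
allVecs : (n k : ℕ) → List (Vec (Fin n) k)
allVecs n zero = [] ∷ []
allVecs n (suc k) = concatMap (λ v → map (λ x → x ∷ v) (Data.List.allFin n)) (allVecs n k)
  where import Data.List

IsHom : ∀ {n} → ECGraph n → Vec (Fin n) 6 → Set
IsHom G f = All (λ { (u , v , c) → col G (lookup f u) (lookup f v) ≡ just c }) C6A-edges

isHom? : ∀ {n} (G : ECGraph n) (f : Vec (Fin n) 6) → Dec (IsHom G f)
isHom? G f = all? (λ { (u , v , c) → col G (lookup f u) (lookup f v) ≟m just c }) C6A-edges

module _ {n : ℕ} where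
  open import Data.List.Relation.Unary.Unique.DecPropositional (FinP._≟_ {n}) using (Unique; unique?)

  IsInj : Vec (Fin n) 6 → Set
  IsInj f = Unique (toList f)

  isInj? : (f : Vec (Fin n) 6) → Dec (IsInj f)
  isInj? f = unique? (toList f)

homInj : ∀ {n} → ECGraph n → ℕ
homInj {n} G = length (filter (λ f → isInj? f ×-dec isHom? G f) (allVecs n 6))

-- falling factorial n (n-1) ⋯ (n-k+1) = n!/(n-k)!  (0 if n < k)
falling : ℕ → ℕ → ℕ
falling n zero = 1
falling n (suc k) = (n ∸ k) * falling n k

-- t_inj(C₆^A, G) = (n-6)!/n! · hom_inj(C₆^A,G), and 0 if n < 6
-- (falling n 6 = 0 exactly when n < 6).
tinj : ∀ {n} → ECGraph n → ℚ
tinj {n} G with falling n 6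
... | zero = 0ℚ
... | suc m = (+ homInj G) / suc m

{-# OPTIONS --safe #-}
module Submission where

-- Put S i j = -1 on red edges and +1 elsewhere. An alternating 6-cycle has weight 64 in the product of the
-- factors 1 - S (red) and 1 + S (blue) around the cycle, and all weights are nonnegative, so 64 hom_inj is at
-- most tr(M³) with M = (J + S)(J - S), the even vertices being summed out. With a_k = 𝟏ᵀ Sᵏ 𝟏,
--   tr(M³) = n⁶ - 3 (2n³a₂ - n²a₁² - 2n a₄ + 2a₁a₃ - a₂²) - tr(S⁶),
-- where tr(S⁶) ≥ 0. The bracket is nonnegative too: for d = S𝟏,
--   a₁ S_ij - d_i d_j = ∑_k (d_k S_ij - S_ik d_j),
-- and Cauchy–Schwarz in k, summed over i and j, is exactly the required inequality because S_ij² = 1.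
-- Hence 64 hom_inj ≤ n⁶, and n⁶ exceeds the falling factorial by at most 15 n⁵.

open import Defs
open import Data.Nat using (ℕ; _≥_)
open import Data.Integer using (+_)
open import Data.Product using (Σ)

import Data.Nat.Base as ℕ
import Data.Nat.Properties as ℕP
import Data.Nat.Tactic.RingSolver as ℕSolver
import Data.Integer.Base as ℤB
import Data.Integer.Properties as ℤP
import Data.Rational.Properties as ℚP
import Data.Rational.Unnormalised.Base as ℚᵘ
import Data.Rational.Unnormalised.Properties as ℚᵘP
import Algebra.Properties.Semiring.Sum ℤP.+-*-semiring as Sum
import Relation.Binary.PropositionalEquality as ≡
open import Data.Fin.Base using (Fin; zero; suc)
open import Data.Integer.Base using (ℤ; 0ℤ; 1ℤ; -[1+_]; +≤+; +<+)
open import Data.Integer.Tactic.RingSolver using (solve-∀)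
open import Data.List.Base using (List; []; _∷_; _++_; map; concatMap; length; filter; tabulate; allFin)
open import Data.List.Relation.Unary.All using ([]; _∷_)
open import Data.Maybe.Base using (Maybe; just; nothing)
open import Data.Nat.Coprimality using (Coprime)
open import Data.Product using (∃; _×_; _,_; proj₂)
open import Data.Rational.Base using (mkℚ; *<*; toℚᵘ)
open import Data.Rational.Unnormalised.Base using (mkℚᵘ)
open import Data.Vec.Base using (Vec; []; _∷_)
open import Function.Base using (_∘_)
open import Relation.Binary.PropositionalEquality using (_≡_; refl; trans; cong; cong₂; subst; subst₂; module ≡-Reasoning)
open import Relation.Nullary using (yes; no)
open import Relation.Unary using (Decidable)

variable
  n : ℕ

module _ where
  open import Data.Integer.Base using (_+_; _*_; _-_; -_; _≤_)

  -- Finite sums of integers.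

  square-nonneg : ∀ x → 0ℤ ≤ x * x
  square-nonneg (+ x)    = ℤP.≤-trans (+≤+ ℕ.z≤n) (ℤP.≤-reflexive (ℤP.pos-* x x))
  square-nonneg -[1+ x ] = +≤+ ℕ.z≤n

  infixr 4 _⊕_
  infixr 5 _⊙_

  -- Opaque, so that the summand can be inferred from the sum.
  opaque
    ∑ : (Fin n → ℤ) → ℤ
    ∑ = Sum.sum

    ∑-cong : {f g : Fin n → ℤ} → (∀ i → f i ≡ g i) → ∑ f ≡ ∑ g
    ∑-cong = Sum.sum-cong-≗

    -- Together with `_⊙_` this evaluates the sum of a linear combination term by term. The `expand`
    -- identities below therefore end in right-nested sums of scalar times summand, with units such
    -- as `1ℤ *` written out, and the chains of `_⊕_` follow the order of their terms.
    _⊕_ : {f g : Fin n → ℤ} {s t : ℤ} → ∑ f ≡ s → ∑ g ≡ t → ∑ (λ i → f i + g i) ≡ s + t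
    _⊕_ {f = f} {g} p q = trans (Sum.∑-distrib-+ f g) (cong₂ _+_ p q)

    _⊙_ : {f : Fin n → ℤ} {s : ℤ} → ∀ c → ∑ f ≡ s → ∑ (λ i → c * f i) ≡ c * s
    _⊙_ {f = f} c p = trans (≡.sym (Sum.*-distribˡ-sum c f)) (cong (c *_) p)

    ∑-comm : ∀ {m} (f : Fin m → Fin n → ℤ) → ∑ (λ i → ∑ (f i)) ≡ ∑ (λ j → ∑ (λ i → f i j))
    ∑-comm = Sum.∑-comm

    ∑-nonneg : {f : Fin n → ℤ} → (∀ i → 0ℤ ≤ f i) → 0ℤ ≤ ∑ f
    ∑-nonneg {ℕ.zero}  0≤f = ℤP.≤-refl
    ∑-nonneg {ℕ.suc n} 0≤f = ℤP.+-mono-≤ (0≤f zero) (∑-nonneg (0≤f ∘ suc))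

    ∑-mono : {f g : Fin n → ℤ} → (∀ i → f i ≤ g i) → ∑ f ≤ ∑ g
    ∑-mono {ℕ.zero}  f≤g = ℤP.≤-refl
    ∑-mono {ℕ.suc n} f≤g = ℤP.+-mono-≤ (f≤g zero) (∑-mono (f≤g ∘ suc))

    ∑-1 : ∀ n → ∑ {n} (λ _ → 1ℤ) ≡ + n
    ∑-1 ℕ.zero    = refl
    ∑-1 (ℕ.suc n) = cong (λ k → 1ℤ + k) (∑-1 n)

  ∑-≡ : {f g : Fin n → ℤ} {s : ℤ} → (∀ i → f i ≡ g i) → ∑ g ≡ s → ∑ f ≡ s
  ∑-≡ f≗g p = trans (∑-cong f≗g) p

  *-∑ : ∀ c (f : Fin n → ℤ) → c * ∑ f ≡ ∑ (λ i → c * f i)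
  *-∑ c f = ≡.sym (c ⊙ refl)

  -- Inner products and symmetric matrices.

  infixl 7 _·_ _⊛_

  _·_ : (Fin n → ℤ) → (Fin n → ℤ) → ℤ
  u · v = ∑ (λ i → u i * v i)

  _⊛_ : (Fin n → Fin n → ℤ) → (Fin n → ℤ) → Fin n → ℤ
  (A ⊛ v) i = A i · v

  𝟏 : Fin n → ℤ
  𝟏 _ = 1ℤ

  Symmetric : (Fin n → Fin n → ℤ) → Set
  Symmetric A = ∀ i j → A i j ≡ A j i

  ·-comm : (u v : Fin n → ℤ) → u · v ≡ v · u
  ·-comm u v = ∑-cong (λ i → ℤP.*-comm (u i) (v i))

  ·-nonneg : (u : Fin n → ℤ) → 0ℤ ≤ u · u
  ·-nonneg u = ∑-nonneg (λ i → square-nonneg (u i))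

  ·-congʳ : (u : Fin n → ℤ) {v w : Fin n → ℤ} → (∀ i → v i ≡ w i) → u · v ≡ u · w
  ·-congʳ u v≗w = ∑-cong (λ i → cong (u i *_) (v≗w i))

  -- Exchanging the order of summation transposes `A`. This is the tool for moving powers of `S`
  -- from one vector to another.
  ⊛-adjoint : (A : Fin n → Fin n → ℤ) → Symmetric A → ∀ u v → u · (A ⊛ v) ≡ (A ⊛ u) · v
  ⊛-adjoint A A-sym u v = begin
    ∑ (λ i → u i * ∑ (λ j → A i j * v j))    ≡⟨ ∑-cong (λ i → *-∑ (u i) _) ⟩
    ∑ (λ i → ∑ (λ j → u i * (A i j * v j)))  ≡⟨ ∑-comm _ ⟩
    ∑ (λ j → ∑ (λ i → u i * (A i j * v j)))  ≡⟨ ∑-cong (λ j → ∑-≡ (λ i → shuffle (u i) (v j) (A-sym i j)) (≡.sym (*-∑ (v j) _))) ⟩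
    ∑ (λ j → v j * ∑ (λ i → A j i * u i))    ≡⟨ ·-comm v (A ⊛ u) ⟩
    (A ⊛ u) · v                              ∎
    where
    open ≡-Reasoning
    ring : ∀ a x y → x * (a * y) ≡ y * (a * x)
    ring = solve-∀
    shuffle : ∀ {a b} x y → a ≡ b → x * (a * y) ≡ y * (b * x)
    shuffle {a} x y refl = ring a x y

  -- Twice the difference of the two sides is ∑ (x i - x j)² over all pairs i, j.
  cauchy-schwarz : ∀ (x : Fin n → ℤ) → ∑ x * ∑ x ≤ ∑ {n} 𝟏 * (x · x)
  cauchy-schwarz {n} x = ℤP.0≤i-j⇒j≤i (ℤP.*-cancelˡ-≤-pos 0ℤ _ (+ 2)
    (ℤP.≤-trans (∑-nonneg (λ i → ∑-nonneg (λ j → square-nonneg (x i - x j)))) (ℤP.≤-reflexive variance)))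
    where
    m  = ∑ {n} 𝟏
    s₁ = ∑ x
    s₂ = x · x
    expand : ∀ a b → (a - b) * (a - b) ≡ (a * a) * 1ℤ + (1ℤ * (b * b) + (- (+ 2)) * a * b)
    expand = solve-∀
    collect : ∀ a m s₁ s₂ → (a * a) * m + (1ℤ * s₂ + (- (+ 2)) * a * s₁)
                          ≡ m * (a * a) + (s₂ * 1ℤ + (- (+ 2)) * s₁ * a)
    collect = solve-∀
    inner : ∀ i → ∑ (λ j → (x i - x j) * (x i - x j)) ≡ m * (x i * x i) + (s₂ * 1ℤ + (- (+ 2)) * s₁ * x i)
    inner i = ∑-≡ (λ j → expand (x i) (x j))
      (trans (((x i * x i) ⊙ refl) ⊕ (1ℤ ⊙ refl) ⊕ ((- (+ 2)) * x i) ⊙ refl) (collect (x i) m s₁ s₂))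
    outer : ∀ m s₁ s₂ → m * s₂ + (s₂ * m + (- (+ 2)) * s₁ * s₁) ≡ (+ 2) * (m * s₂ - s₁ * s₁)
    outer = solve-∀
    variance : ∑ (λ i → ∑ (λ j → (x i - x j) * (x i - x j))) ≡ (+ 2) * (m * s₂ - s₁ * s₁)
    variance = ∑-≡ inner (trans ((m ⊙ refl) ⊕ (s₂ ⊙ refl) ⊕ ((- (+ 2)) * s₁) ⊙ refl) (outer m s₁ s₂))

  -- Powers of a symmetric sign matrix.

  module SignMatrix (S : Fin n → Fin n → ℤ) (S-sym : Symmetric S) (S²≡1 : ∀ i j → S i j * S i j ≡ 1ℤ) where

    N : ℤ
    N = ∑ {n} 𝟏

    d e f g h : Fin n → ℤ
    d = S ⊛ 𝟏
    e = S ⊛ d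
    f = S ⊛ e
    g = S ⊛ f
    h = S ⊛ g

    -- By symmetry of `S` these are 𝟏ᵀ Sᵏ 𝟏 for k = 1, ..., 4. Other ways of splitting Sᵏ between
    -- the two factors are reconciled by adjointness below.
    a₁ a₂ a₃ a₄ : ℤ
    a₁ = 𝟏 · d
    a₂ = d · d
    a₃ = d · e
    a₄ = e · e

    -- This is S², since `S` is symmetric; in Gram form its own symmetry is immediate.
    T : Fin n → Fin n → ℤ
    T i j = S i · S j

    T-sym : Symmetric T
    T-sym i j = ·-comm (S i) (S j)

    T⊛ : ∀ v i → (T ⊛ v) i ≡ (S ⊛ (S ⊛ v)) i
    T⊛ v i = trans (∑-cong (λ j → cong (_* v j) (T-sym i j))) (≡.sym (⊛-adjoint S S-sym (S i) v))

    -- The diagonal of T³ = S⁶, so `∑ w` is tr(S⁶).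
    w : Fin n → ℤ
    w a = T a · (T ⊛ T a)

    -- A diagonal entry of S⁶ is the squared length of a row of S³.
    w-nonneg : ∀ a → 0ℤ ≤ w a
    w-nonneg a = subst (0ℤ ≤_) (≡.sym w≡) (·-nonneg (S ⊛ T a))
      where
      w≡ : w a ≡ (S ⊛ T a) · (S ⊛ T a)
      w≡ = trans (·-congʳ (T a) (T⊛ (T a))) (⊛-adjoint S S-sym (T a) (S ⊛ T a))

    𝟏·e : 𝟏 · e ≡ a₂
    𝟏·e = ⊛-adjoint S S-sym 𝟏 d

    𝟏·f : 𝟏 · f ≡ a₃
    𝟏·f = ⊛-adjoint S S-sym 𝟏 e

    d·f : d · f ≡ a₄
    d·f = ⊛-adjoint S S-sym d e

    𝟏·g : 𝟏 · g ≡ a₄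
    𝟏·g = trans (⊛-adjoint S S-sym 𝟏 f) d·f

    -- `T ⊛ T a` is row a of S⁴, so pairing it with 𝟏 or S𝟏 gives an entry of S⁴𝟏 or S⁵𝟏.
    TT·𝟏 : ∀ a → (T ⊛ T a) · 𝟏 ≡ g a
    TT·𝟏 a = trans (≡.sym (⊛-adjoint T T-sym (T a) 𝟏)) (trans (·-congʳ (T a) (T⊛ 𝟏)) (T⊛ e a))

    TT·d : ∀ a → (T ⊛ T a) · d ≡ h a
    TT·d a = trans (≡.sym (⊛-adjoint T T-sym (T a) d)) (trans (·-congʳ (T a) (T⊛ d)) (T⊛ f a))

    -- The trace of the cube of (J + S)(J - S).

    M : Fin n → Fin n → ℤ
    M a b = ∑ (λ x → (1ℤ + S a x) * (1ℤ - S x b))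

    -- The four terms are the entries of J² = N J, S J, - J S and - S².
    M-closed : ∀ a b → M a b ≡ N + d a - d b - T a b
    M-closed a b = ∑-≡ (λ x → trans (cong (λ s → (1ℤ + S a x) * (1ℤ - s)) (S-sym x b)) (expand (S a x) (S b x)))
      (trans ((1ℤ ⊙ refl) ⊕ (1ℤ ⊙ refl) ⊕ (- 1ℤ ⊙ refl) ⊕ (- 1ℤ ⊙ refl)) (collect N (d a) (d b) (T a b)))
      where
      expand : ∀ s t → (1ℤ + s) * (1ℤ - t)
        ≡ 1ℤ * 1ℤ + (1ℤ * (s * 1ℤ) + (- 1ℤ * (t * 1ℤ) + - 1ℤ * (s * t)))
      expand = solve-∀
      collect : ∀ m x y t → 1ℤ * m + (1ℤ * x + (- 1ℤ * y + - 1ℤ * t)) ≡ m + x - y - t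
      collect = solve-∀

    -- For fixed a the right side is a linear combination of 𝟏, `d`, `e`, `f` and row a of S⁴,
    -- evaluated at c. Multiplying by `M` once more and summing over c then needs only known inner
    -- products.
    M²-closed : ∀ a c → ∑ (λ b → M a b * M b c)
      ≡ (N * N * N + (N * N + a₁) * d a - a₂ - N * e a - f a)
        + (a₁ + e a - N * (N + d a)) * d c + - (N + d a) * e c + f c + (T ⊛ T a) c
    M²-closed a c = ∑-≡
      (λ b → trans (cong₂ _*_ (M-closed a b) (trans (M-closed b c) (cong (λ t → N + d b - d c - t) (T-sym b c))))
                   (expand N (d a) (d b) (d c) (T a b) (T c b)))
      (trans (((N + d a) * (N - d c) ⊙ refl) ⊕ (d a + d c ⊙ refl) ⊕ (- 1ℤ ⊙ refl) ⊕ (- (N + d a) ⊙ T⊛ 𝟏 c)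
               ⊕ (1ℤ ⊙ T⊛ d c) ⊕ (- (N - d c) ⊙ T⊛ 𝟏 a) ⊕ (- 1ℤ ⊙ T⊛ d a) ⊕ (1ℤ ⊙ refl))
             (collect N a₁ a₂ (d a) (e a) (f a) (d c) (e c) (f c) ((T ⊛ T a) c)))
      where
      expand : ∀ m x y z s t → (m + x - y - s) * (m + y - z - t)
        ≡ (m + x) * (m - z) * 1ℤ + ((x + z) * (1ℤ * y) + (- 1ℤ * (y * y) + (- (m + x) * (t * 1ℤ)
          + (1ℤ * (t * y) + (- (m - z) * (s * 1ℤ) + (- 1ℤ * (s * y) + 1ℤ * (t * s)))))))
      expand = solve-∀
      collect : ∀ m a₁ a₂ x ex fx z ez fz u →
        (m + x) * (m - z) * m + ((x + z) * a₁ + (- 1ℤ * a₂ + (- (m + x) * ez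
          + (1ℤ * fz + (- (m - z) * ex + (- 1ℤ * fx + 1ℤ * u))))))
        ≡ (m * m * m + (m * m + a₁) * x - a₂ - m * ex - fx)
          + (a₁ + ex - m * (m + x)) * z + - (m + x) * ez + fz + u
      collect = solve-∀

    -- The contributions of `h a` from `TT·d` and from `T⊛ f` cancel, as do the terms `d a * g a`;
    -- hence no 𝟏ᵀ S⁵ 𝟏 appears after summation over a.
    M³-row : ∀ a → ∑ (λ c → ∑ (λ b → M a b * M b c) * M c a)
      ≡ (N * N * N * N * N + - (+ 3) * (N * N * a₂) + N * (a₁ * a₁) + a₄) * 1ℤ
        + ((+ 2) * (N * N * a₁ - a₃) * (1ℤ * d a) + ((+ 2) * (a₂ - N * N * N) * (1ℤ * e a)
        + (- (+ 2) * a₁ * (1ℤ * f a) + ((a₂ - N * N * N) * (d a * d a) + (- (+ 2) * a₁ * (d a * e a)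
        + ((+ 2) * N * (d a * f a) + (N * (e a * e a) + ((+ 2) * N * (1ℤ * g a) + - 1ℤ * w a))))))))
    M³-row a = ∑-≡
      (λ c → trans (cong₂ _*_ (M²-closed a c) (trans (M-closed c a) (cong (λ t → N + d c - d a - t) (T-sym c a))))
                   (expand v₀ v₁ v₂ N (d a) (d c) (e c) (f c) ((T ⊛ T a) c) (T a c)))
      (trans ((v₀ * (N - d a) ⊙ refl) ⊕ (v₀ + v₁ * (N - d a) ⊙ refl) ⊕ (v₁ ⊙ refl) ⊕ (v₂ * (N - d a) ⊙ 𝟏·e)
               ⊕ (v₂ ⊙ refl) ⊕ (N - d a ⊙ 𝟏·f) ⊕ (1ℤ ⊙ d·f) ⊕ (N - d a ⊙ TT·𝟏 a) ⊕ (1ℤ ⊙ TT·d a)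
               ⊕ (- v₀ ⊙ T⊛ 𝟏 a) ⊕ (- v₁ ⊙ T⊛ d a) ⊕ (- v₂ ⊙ T⊛ e a) ⊕ (- 1ℤ ⊙ T⊛ f a) ⊕ (- 1ℤ ⊙ refl))
             (collect N a₁ a₂ a₃ a₄ (d a) (e a) (f a) (g a) (h a) (w a)))
      where
      v₀ = N * N * N + (N * N + a₁) * d a - a₂ - N * e a - f a
      v₁ = a₁ + e a - N * (N + d a)
      v₂ = - (N + d a)
      expand : ∀ v₀ v₁ v₂ m x z ez fz u t →
        (v₀ + v₁ * z + v₂ * ez + fz + u) * (m + z - x - t)
        ≡ v₀ * (m - x) * 1ℤ + ((v₀ + v₁ * (m - x)) * (1ℤ * z) + (v₁ * (z * z) + (v₂ * (m - x) * (1ℤ * ez)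
          + (v₂ * (z * ez) + ((m - x) * (1ℤ * fz) + (1ℤ * (z * fz) + ((m - x) * (u * 1ℤ) + (1ℤ * (u * z)
          + (- v₀ * (t * 1ℤ) + (- v₁ * (t * z) + (- v₂ * (t * ez) + (- 1ℤ * (t * fz) + - 1ℤ * (t * u)))))))))))))
      expand = solve-∀
      collect : ∀ m a₁ a₂ a₃ a₄ x ex fx gx hx wx →
        (m * m * m + (m * m + a₁) * x - a₂ - m * ex - fx) * (m - x) * m
          + (((m * m * m + (m * m + a₁) * x - a₂ - m * ex - fx) + (a₁ + ex - m * (m + x)) * (m - x)) * a₁
          + ((a₁ + ex - m * (m + x)) * a₂ + (- (m + x) * (m - x) * a₂
          + (- (m + x) * a₃ + ((m - x) * a₃ + (1ℤ * a₄ + ((m - x) * gx + (1ℤ * hx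
          + (- (m * m * m + (m * m + a₁) * x - a₂ - m * ex - fx) * ex
          + (- (a₁ + ex - m * (m + x)) * fx + (- - (m + x) * gx + (- 1ℤ * hx + - 1ℤ * wx))))))))))))
        ≡ (m * m * m * m * m + - (+ 3) * (m * m * a₂) + m * (a₁ * a₁) + a₄) * 1ℤ
          + ((+ 2) * (m * m * a₁ - a₃) * (1ℤ * x) + ((+ 2) * (a₂ - m * m * m) * (1ℤ * ex)
          + (- (+ 2) * a₁ * (1ℤ * fx) + ((a₂ - m * m * m) * (x * x) + (- (+ 2) * a₁ * (x * ex)
          + ((+ 2) * m * (x * fx) + (m * (ex * ex) + ((+ 2) * m * (1ℤ * gx) + - 1ℤ * wx))))))))
      collect = solve-∀

    -- The bracket is left as a difference of the two quantities that `bracket-≤` compares.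
    tr-M³ : ∑ (λ a → ∑ (λ c → ∑ (λ b → M a b * M b c) * M c a))
      ≡ N * N * N * N * N * N
        - ((+ 3) * (((+ 2) * (N * N * N * a₂) - (+ 2) * (N * a₄)) - (N * N * (a₁ * a₁) - (+ 2) * (a₁ * a₃) + a₂ * a₂)) + ∑ w)
    tr-M³ = ∑-≡ M³-row
      (trans ((N * N * N * N * N + - (+ 3) * (N * N * a₂) + N * (a₁ * a₁) + a₄ ⊙ refl)
               ⊕ ((+ 2) * (N * N * a₁ - a₃) ⊙ refl) ⊕ ((+ 2) * (a₂ - N * N * N) ⊙ 𝟏·e) ⊕ (- (+ 2) * a₁ ⊙ 𝟏·f)
               ⊕ (a₂ - N * N * N ⊙ refl) ⊕ (- (+ 2) * a₁ ⊙ refl) ⊕ ((+ 2) * N ⊙ d·f) ⊕ (N ⊙ refl)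
               ⊕ ((+ 2) * N ⊙ 𝟏·g) ⊕ (- 1ℤ ⊙ refl))
             (collect N a₁ a₂ a₃ a₄ (∑ w)))
      where
      collect : ∀ m a₁ a₂ a₃ a₄ W →
        (m * m * m * m * m + - (+ 3) * (m * m * a₂) + m * (a₁ * a₁) + a₄) * m
          + ((+ 2) * (m * m * a₁ - a₃) * a₁ + ((+ 2) * (a₂ - m * m * m) * a₂
          + (- (+ 2) * a₁ * a₃ + ((a₂ - m * m * m) * a₂ + (- (+ 2) * a₁ * a₃
          + ((+ 2) * m * a₄ + (m * a₄ + ((+ 2) * m * a₄ + - 1ℤ * W))))))))
        ≡ m * m * m * m * m * m
          - ((+ 3) * (((+ 2) * (m * m * m * a₂) - (+ 2) * (m * a₄)) - (m * m * (a₁ * a₁) - (+ 2) * (a₁ * a₃) + a₂ * a₂)) + W)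
      collect = solve-∀

    -- The bracket inequality from Cauchy-Schwarz.

    X : Fin n → Fin n → Fin n → ℤ
    X i j k = d k * S i j - S i k * d j

    ∑X : ∀ i j → ∑ (X i j) ≡ S i j * a₁ + - d j * d i
    ∑X i j = ∑-≡ (λ k → expand (d k) (S i j) (S i k) (d j)) ((S i j ⊙ refl) ⊕ (- d j ⊙ refl))
      where
      expand : ∀ z s t y → z * s - t * y ≡ s * (1ℤ * z) + - y * (t * 1ℤ)
      expand = solve-∀

    -- This is the squared Frobenius norm of a₁ S - d dᵀ: the entries of `S` square to 1, and the
    -- cross term contains dᵀ S d = a₃.
    ∑[∑X]² : ∑ (λ i → ∑ (λ j → ∑ (X i j) * ∑ (X i j)))
      ≡ N * N * (a₁ * a₁) - (+ 2) * (a₁ * a₃) + a₂ * a₂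
    ∑[∑X]² = ∑-≡ row (trans ((N * (a₁ * a₁) ⊙ refl) ⊕ (- (+ 2) * a₁ ⊙ refl) ⊕ (a₂ ⊙ refl)) (total N a₁ a₂ a₃))
      where
      expand : ∀ s a x y → (s * a + - y * x) * (s * a + - y * x)
        ≡ (a * a) * (s * s) + (- (+ 2) * a * x * (s * y) + x * x * (y * y))
      expand = solve-∀
      collect : ∀ m a a₂ x ex → (a * a) * m + (- (+ 2) * a * x * ex + x * x * a₂)
        ≡ m * (a * a) * 1ℤ + (- (+ 2) * a * (x * ex) + a₂ * (x * x))
      collect = solve-∀
      total : ∀ m a₁ a₂ a₃ → m * (a₁ * a₁) * m + (- (+ 2) * a₁ * a₃ + a₂ * a₂)
        ≡ m * m * (a₁ * a₁) - (+ 2) * (a₁ * a₃) + a₂ * a₂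
      total = solve-∀
      term : ∀ i j → ∑ (X i j) * ∑ (X i j)
        ≡ (a₁ * a₁) * 1ℤ + (- (+ 2) * a₁ * d i * (S i j * d j) + d i * d i * (d j * d j))
      term i j = trans (cong₂ _*_ (∑X i j) (∑X i j)) (trans (expand (S i j) a₁ (d i) (d j))
        (cong (λ s → (a₁ * a₁) * s + (- (+ 2) * a₁ * d i * (S i j * d j) + d i * d i * (d j * d j))) (S²≡1 i j)))
      row : ∀ i → ∑ (λ j → ∑ (X i j) * ∑ (X i j))
        ≡ N * (a₁ * a₁) * 1ℤ + (- (+ 2) * a₁ * (d i * e i) + a₂ * (d i * d i))
      row i = ∑-≡ (term i) (trans ((a₁ * a₁ ⊙ refl) ⊕ (- (+ 2) * a₁ * d i ⊙ refl) ⊕ (d i * d i ⊙ refl))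
        (collect N a₁ a₂ (d i) (e i)))

    -- Each of the two squares in X² contributes N² a₂ to the triple sum. In the cross term the sums
    -- over j and k both produce `e i`, which leaves - 2 a₄.
    ∑X² : ∑ (λ i → ∑ (λ j → N * (X i j · X i j))) ≡ (+ 2) * (N * N * N * a₂) - (+ 2) * (N * a₄)
    ∑X² = ∑-≡ row (trans (((+ 2) * (N * N * a₂) ⊙ refl) ⊕ (- (+ 2) * N ⊙ refl)) (total N a₂ a₄))
      where
      expand : ∀ z s t y → (z * s - t * y) * (z * s - t * y)
        ≡ (s * s) * (z * z) + (- (+ 2) * y * s * (t * z) + y * y * (t * t))
      expand = solve-∀
      collect₁ : ∀ m a₂ s y ex → m * (1ℤ * a₂ + (- (+ 2) * y * s * ex + y * y * m))
        ≡ m * a₂ * 1ℤ + (- (+ 2) * m * ex * (s * y) + m * m * (y * y))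
      collect₁ = solve-∀
      collect₂ : ∀ m a₂ ex → m * a₂ * m + (- (+ 2) * m * ex * ex + m * m * a₂)
        ≡ (+ 2) * (m * m * a₂) * 1ℤ + - (+ 2) * m * (ex * ex)
      collect₂ = solve-∀
      total : ∀ m a₂ a₄ → (+ 2) * (m * m * a₂) * m + - (+ 2) * m * a₄
        ≡ (+ 2) * (m * m * m * a₂) - (+ 2) * (m * a₄)
      total = solve-∀
      term : ∀ i j k → X i j k * X i j k
        ≡ 1ℤ * (d k * d k) + (- (+ 2) * d j * S i j * (S i k * d k) + d j * d j * 1ℤ)
      term i j k = trans (expand (d k) (S i j) (S i k) (d j))
        (cong₂ (λ s t → s * (d k * d k) + (- (+ 2) * d j * S i j * (S i k * d k) + d j * d j * t)) (S²≡1 i j) (S²≡1 i k))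
      entry : ∀ i j → N * (X i j · X i j)
        ≡ N * a₂ * 1ℤ + (- (+ 2) * N * e i * (S i j * d j) + N * N * (d j * d j))
      entry i j = trans
        (cong (N *_) (∑-≡ (term i j) ((1ℤ ⊙ refl) ⊕ (- (+ 2) * d j * S i j ⊙ refl) ⊕ (d j * d j ⊙ refl))))
        (collect₁ N a₂ (S i j) (d j) (e i))
      row : ∀ i → ∑ (λ j → N * (X i j · X i j)) ≡ (+ 2) * (N * N * a₂) * 1ℤ + - (+ 2) * N * (e i * e i)
      row i = ∑-≡ (entry i) (trans ((N * a₂ ⊙ refl) ⊕ (- (+ 2) * N * e i ⊙ refl) ⊕ (N * N ⊙ refl))
        (collect₂ N a₂ (e i)))

    bracket-≤ : N * N * (a₁ * a₁) - (+ 2) * (a₁ * a₃) + a₂ * a₂ ≤ (+ 2) * (N * N * N * a₂) - (+ 2) * (N * a₄)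
    bracket-≤ = subst₂ _≤_ ∑[∑X]² ∑X² (∑-mono (λ i → ∑-mono (λ j → cauchy-schwarz (X i j))))

    tr-M³-bound : ∑ (λ a → ∑ (λ c → ∑ (λ b → M a b * M b c) * M c a)) ≤ N * N * N * N * N * N
    tr-M³-bound = subst (_≤ N * N * N * N * N * N) (≡.sym tr-M³) (minus-nonneg
      (ℤP.+-mono-≤ (ℤP.*-monoˡ-≤-nonNeg (+ 3) (ℤP.i≤j⇒0≤j-i bracket-≤)) (∑-nonneg w-nonneg)))
      where
      minus-nonneg : ∀ {x y} → 0ℤ ≤ y → x - y ≤ x
      minus-nonneg {x} {+ y} _ = ℤP.i-j≤i x (+ y)

  -- Weighted counting over lists of maps.

  ∑ᴸ : ∀ {A : Set} → List A → (A → ℤ) → ℤ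
  ∑ᴸ []       w = 0ℤ
  ∑ᴸ (x ∷ xs) w = w x + ∑ᴸ xs w

  -- Markov's inequality: an element that is not counted can only enlarge the right side.
  count-bound : ∀ {A : Set} {P : A → Set} (P? : Decidable P) (w : A → ℤ) c →
    (∀ x → 0ℤ ≤ w x) → (∀ x → P x → c ≤ w x) → ∀ xs → c * + length (filter P? xs) ≤ ∑ᴸ xs w
  count-bound P? w c 0≤w c≤w [] = ℤP.≤-reflexive (ℤP.*-zeroʳ c)
  count-bound P? w c 0≤w c≤w (x ∷ xs) with P? x
  ... | no  _  = subst (_≤ w x + ∑ᴸ xs w) (ℤP.+-identityˡ _) (ℤP.+-mono-≤ (0≤w x) (count-bound P? w c 0≤w c≤w xs))
  ... | yes px = subst (_≤ w x + ∑ᴸ xs w) (≡.sym (distrib c (+ length (filter P? xs))))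
    (ℤP.+-mono-≤ (c≤w x px) (count-bound P? w c 0≤w c≤w xs))
    where
    distrib : ∀ c l → c * (1ℤ + l) ≡ c + c * l
    distrib = solve-∀

  ∑ᴸ-++ : ∀ {A : Set} (xs ys : List A) w → ∑ᴸ (xs ++ ys) w ≡ ∑ᴸ xs w + ∑ᴸ ys w
  ∑ᴸ-++ []       ys w = ≡.sym (ℤP.+-identityˡ _)
  ∑ᴸ-++ (x ∷ xs) ys w = trans (cong (λ s → w x + s) (∑ᴸ-++ xs ys w)) (≡.sym (ℤP.+-assoc (w x) _ _))

  ∑ᴸ-map : ∀ {A B : Set} (t : A → B) xs w → ∑ᴸ (map t xs) w ≡ ∑ᴸ xs (λ x → w (t x))
  ∑ᴸ-map t []       w = refl
  ∑ᴸ-map t (x ∷ xs) w = cong (λ s → w (t x) + s) (∑ᴸ-map t xs w)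

  ∑ᴸ-concatMap : ∀ {A B : Set} (t : A → List B) xs w → ∑ᴸ (concatMap t xs) w ≡ ∑ᴸ xs (λ x → ∑ᴸ (t x) w)
  ∑ᴸ-concatMap t []       w = refl
  ∑ᴸ-concatMap t (x ∷ xs) w = trans (∑ᴸ-++ (t x) (concatMap t xs) w) (cong (λ s → ∑ᴸ (t x) w + s) (∑ᴸ-concatMap t xs w))

  ∑ᴸ-cong : ∀ {A : Set} (xs : List A) {v w : A → ℤ} → (∀ x → v x ≡ w x) → ∑ᴸ xs v ≡ ∑ᴸ xs w
  ∑ᴸ-cong []       v≗w = refl
  ∑ᴸ-cong (x ∷ xs) v≗w = cong₂ _+_ (v≗w x) (∑ᴸ-cong xs v≗w)

  opaque
    unfolding ∑

    ∑ᴸ-tabulate : ∀ {A : Set} (t : Fin n → A) w → ∑ᴸ (tabulate t) w ≡ ∑ (λ i → w (t i))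
    ∑ᴸ-tabulate {ℕ.zero}  t w = refl
    ∑ᴸ-tabulate {ℕ.suc n} t w = cong (λ s → w (t zero) + s) (∑ᴸ-tabulate (t ∘ suc) w)

  -- The nesting follows `allVecs`: the head is summed innermost and the last coordinate outermost.
  ∑ⱽ : ∀ k → (Vec (Fin n) k → ℤ) → ℤ
  ∑ⱽ ℕ.zero    w = w []
  ∑ⱽ (ℕ.suc k) w = ∑ⱽ k (λ v → ∑ (λ x → w (x ∷ v)))

  ∑ᴸ-allVecs : ∀ k (w : Vec (Fin n) k → ℤ) → ∑ᴸ (allVecs n k) w ≡ ∑ⱽ k w
  ∑ᴸ-allVecs     ℕ.zero    w = ℤP.+-identityʳ (w [])
  ∑ᴸ-allVecs {n} (ℕ.suc k) w = trans (∑ᴸ-concatMap _ (allVecs n k) w) (trans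
    (∑ᴸ-cong (allVecs n k) (λ v → trans (∑ᴸ-map (_∷ v) (allFin n) w) (∑ᴸ-tabulate (λ x → x) (λ x → w (x ∷ v)))))
    (∑ᴸ-allVecs k _))

  -- From the graph to the trace of the sign matrix.

  *-nonneg : ∀ {x y} → 0ℤ ≤ x → 0ℤ ≤ y → 0ℤ ≤ x * y
  *-nonneg {+ x} {+ y} _ _ = subst (0ℤ ≤_) (ℤP.pos-* x y) (+≤+ ℕ.z≤n)

  -- Non-edges, loops included, count as blue: this makes every entry ±1 and only increases the weight below.
  sign : Maybe Colour → ℤ
  sign (just red) = - 1ℤ
  sign _          = 1ℤ

  sign² : ∀ c → sign c * sign c ≡ 1ℤ
  sign² (just red)  = refl
  sign² (just blue) = refl
  sign² nothing     = refl

  1+sign-nonneg : ∀ c → 0ℤ ≤ 1ℤ + sign c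
  1+sign-nonneg (just red)  = +≤+ ℕ.z≤n
  1+sign-nonneg (just blue) = +≤+ ℕ.z≤n
  1+sign-nonneg nothing     = +≤+ ℕ.z≤n

  1-sign-nonneg : ∀ c → 0ℤ ≤ 1ℤ - sign c
  1-sign-nonneg (just red)  = +≤+ ℕ.z≤n
  1-sign-nonneg (just blue) = +≤+ ℕ.z≤n
  1-sign-nonneg nothing     = +≤+ ℕ.z≤n

  module _ (G : ECGraph n) where

    S : Fin n → Fin n → ℤ
    S i j = sign (col G i j)

    open SignMatrix S (λ i j → cong sign (ECGraph.sym G i j)) (λ i j → sign² (col G i j))

    weight : Vec (Fin n) 6 → ℤ
    weight (x₀ ∷ x₁ ∷ x₂ ∷ x₃ ∷ x₄ ∷ x₅ ∷ []) =
      (1ℤ - S x₀ x₁) * (1ℤ + S x₁ x₂) * (1ℤ - S x₂ x₃) * (1ℤ + S x₃ x₄) * (1ℤ - S x₄ x₅) * (1ℤ + S x₅ x₀)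

    weight-nonneg : ∀ v → 0ℤ ≤ weight v
    weight-nonneg (x₀ ∷ x₁ ∷ x₂ ∷ x₃ ∷ x₄ ∷ x₅ ∷ []) =
      *-nonneg (*-nonneg (*-nonneg (*-nonneg (*-nonneg
        (1-sign-nonneg (col G x₀ x₁)) (1+sign-nonneg (col G x₁ x₂))) (1-sign-nonneg (col G x₂ x₃)))
        (1+sign-nonneg (col G x₃ x₄))) (1-sign-nonneg (col G x₄ x₅))) (1+sign-nonneg (col G x₅ x₀))

    -- On a homomorphism each of the six factors is 2.
    weight-hom : ∀ v → IsHom G v → weight v ≡ + 64
    weight-hom (x₀ ∷ x₁ ∷ x₂ ∷ x₃ ∷ x₄ ∷ x₅ ∷ []) (p₀ ∷ p₁ ∷ p₂ ∷ p₃ ∷ p₄ ∷ p₅ ∷ [])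
      rewrite p₀ | p₁ | p₂ | p₃ | p₄ | p₅ = refl

    -- Each even vertex meets one blue and one red factor, so summing it out leaves an entry of `M`:
    -- x₀ gives `M x₅ x₁`, x₂ gives `M x₁ x₃` and x₄ gives `M x₃ x₅`. The odd vertices x₅, x₃, x₁
    -- become a, c, b.
    ∑-weight : ∑ⱽ 6 weight ≡ ∑ (λ a → ∑ (λ c → ∑ (λ b → M a b * M b c) * M c a))
    ∑-weight = ∑-cong λ x₅ → begin
      ∑ (λ x₄ → ∑ λ x₃ → ∑ λ x₂ → ∑ λ x₁ → ∑ λ x₀ → weight (x₀ ∷ x₁ ∷ x₂ ∷ x₃ ∷ x₄ ∷ x₅ ∷ []))
        ≡⟨ (∑-cong λ x₄ → ∑-cong λ x₃ → inner x₃ x₄ x₅) ⟩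
      ∑ (λ x₄ → ∑ λ x₃ → ∑ (λ x₁ → M x₅ x₁ * M x₁ x₃) * ((1ℤ + S x₃ x₄) * (1ℤ - S x₄ x₅)))
        ≡⟨ ∑-comm _ ⟩
      ∑ (λ x₃ → ∑ λ x₄ → ∑ (λ x₁ → M x₅ x₁ * M x₁ x₃) * ((1ℤ + S x₃ x₄) * (1ℤ - S x₄ x₅)))
        ≡⟨ (∑-cong λ x₃ → ∑ (λ x₁ → M x₅ x₁ * M x₁ x₃) ⊙ refl) ⟩
      ∑ (λ x₃ → ∑ (λ x₁ → M x₅ x₁ * M x₁ x₃) * M x₃ x₅)
        ∎
      where
      open ≡-Reasoning
      rotate₀ : ∀ p₀ q₁ p₂ q₃ p₄ q₅ → p₀ * q₁ * p₂ * q₃ * p₄ * q₅ ≡ (q₁ * p₂ * (q₃ * p₄)) * (q₅ * p₀)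
      rotate₀ = solve-∀
      rotate₂ : ∀ q₁ p₂ r m → q₁ * p₂ * r * m ≡ (r * m) * (q₁ * p₂)
      rotate₂ = solve-∀
      inner : ∀ x₃ x₄ x₅ → ∑ (λ x₂ → ∑ λ x₁ → ∑ λ x₀ → weight (x₀ ∷ x₁ ∷ x₂ ∷ x₃ ∷ x₄ ∷ x₅ ∷ []))
        ≡ ∑ (λ x₁ → M x₅ x₁ * M x₁ x₃) * ((1ℤ + S x₃ x₄) * (1ℤ - S x₄ x₅))
      inner x₃ x₄ x₅ = begin
        ∑ (λ x₂ → ∑ λ x₁ → ∑ λ x₀ → weight (x₀ ∷ x₁ ∷ x₂ ∷ x₃ ∷ x₄ ∷ x₅ ∷ []))
          ≡⟨ (∑-cong λ x₂ → ∑-cong λ x₁ → ∑-≡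
               (λ x₀ → rotate₀ (1ℤ - S x₀ x₁) (1ℤ + S x₁ x₂) (1ℤ - S x₂ x₃) (1ℤ + S x₃ x₄) (1ℤ - S x₄ x₅) (1ℤ + S x₅ x₀))
               ((1ℤ + S x₁ x₂) * (1ℤ - S x₂ x₃) * r ⊙ refl)) ⟩
        ∑ (λ x₂ → ∑ λ x₁ → (1ℤ + S x₁ x₂) * (1ℤ - S x₂ x₃) * r * M x₅ x₁)
          ≡⟨ ∑-comm _ ⟩
        ∑ (λ x₁ → ∑ λ x₂ → (1ℤ + S x₁ x₂) * (1ℤ - S x₂ x₃) * r * M x₅ x₁)
          ≡⟨ (∑-cong λ x₁ → ∑-≡ (λ x₂ → rotate₂ (1ℤ + S x₁ x₂) (1ℤ - S x₂ x₃) r (M x₅ x₁)) (r * M x₅ x₁ ⊙ refl)) ⟩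
        ∑ (λ x₁ → r * M x₅ x₁ * M x₁ x₃)
          ≡⟨ ∑-≡ (λ x₁ → ℤP.*-assoc r (M x₅ x₁) (M x₁ x₃)) (r ⊙ refl) ⟩
        r * ∑ (λ x₁ → M x₅ x₁ * M x₁ x₃)
          ≡⟨ ℤP.*-comm r _ ⟩
        ∑ (λ x₁ → M x₅ x₁ * M x₁ x₃) * r
          ∎
        where
        r = (1ℤ + S x₃ x₄) * (1ℤ - S x₄ x₅)

    homInj-bound : 64 ℕ.* homInj G ℕ.≤ n ℕ.* n ℕ.* n ℕ.* n ℕ.* n ℕ.* n
    homInj-bound = ℤP.drop‿+≤+ (begin
      + (64 ℕ.* homInj G)                                             ≡⟨ ℤP.pos-* 64 (homInj G) ⟩
      + 64 * + homInj G                                               ≤⟨ count-bound _ weight (+ 64) weight-nonneg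
                                                                           (λ v p → ℤP.≤-reflexive (≡.sym (weight-hom v (proj₂ p))))
                                                                           (allVecs n 6) ⟩
      ∑ᴸ (allVecs n 6) weight                                         ≡⟨ ∑ᴸ-allVecs 6 weight ⟩
      ∑ⱽ 6 weight                                                     ≡⟨ ∑-weight ⟩
      ∑ (λ a → ∑ (λ c → ∑ (λ b → M a b * M b c) * M c a))             ≤⟨ tr-M³-bound ⟩
      N * N * N * N * N * N                                           ≡⟨ cong (λ m → m * m * m * m * m * m) (∑-1 n) ⟩
      + n * + n * + n * + n * + n * + n                               ≡⟨ ≡.sym pos-n⁶ ⟩
      + (n ℕ.* n ℕ.* n ℕ.* n ℕ.* n ℕ.* n)                             ∎)
      where
      open ℤP.≤-Reasoning
      pos-*-step : ∀ {x i} → + x ≡ i → + (x ℕ.* n) ≡ i * + n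
      pos-*-step {x} x≡i = trans (ℤP.pos-* x n) (cong (_* + n) x≡i)
      pos-n⁶ : + (n ℕ.* n ℕ.* n ℕ.* n ℕ.* n ℕ.* n) ≡ + n * + n * + n * + n * + n * + n
      pos-n⁶ = pos-*-step {n ℕ.* n ℕ.* n ℕ.* n ℕ.* n} (pos-*-step {n ℕ.* n ℕ.* n ℕ.* n}
        (pos-*-step {n ℕ.* n ℕ.* n} (pos-*-step {n ℕ.* n} (pos-*-step {n} refl))))

-- Comparison of n⁶ with the falling factorial.

module _ where
  open import Data.Nat.Base using (_+_; _*_; _≤_)

  -- Here 15 = 1 + 2 + 3 + 4 + 5 cancels the n⁵ term for n = 5 + m. The shift by 5 removes truncated
  -- subtraction from `falling` and makes all coefficients of the remainder nonnegative.
  expand-falling : ∀ m →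
    m * ((1 + m) * ((2 + m) * ((3 + m) * ((4 + m) * ((5 + m) * 1)))))
      + 15 * ((5 + m) * (5 + m) * (5 + m) * (5 + m) * (5 + m))
    ≡ (5 + m) * (5 + m) * (5 + m) * (5 + m) * (5 + m) * (5 + m)
      + (5 + m) * (85 * m * m * m + 1050 * m * m + 4399 * m + 6250)
  expand-falling = ℕSolver.solve-∀

  falling-bound : ∀ n → 5 ≤ n → n * n * n * n * n * n ≤ falling n 6 + 15 * (n * n * n * n * n)
  falling-bound n 5≤n with ℕP.m≤n⇒∃[o]m+o≡n 5≤n
  ... | m , refl = begin
    k * k * k * k * k * k                                                        ≤⟨ ℕP.m≤m+n (k * k * k * k * k * k) _ ⟩
    k * k * k * k * k * k + k * (85 * m * m * m + 1050 * m * m + 4399 * m + 6250)  ≡⟨ ≡.sym (expand-falling m) ⟩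
    falling k 6 + 15 * (k * k * k * k * k)                                       ∎
    where
    open ℕP.≤-Reasoning
    k = 5 + m

  -- For q > 0 this is n⁶ / (64 · falling n 6) ≤ 1/64 + 1/q without division. After `falling-bound`
  -- is multiplied by q + 64, the error n⁵ · 15 (q + 64) is at most n⁶, hence at most the 64 n⁶ that
  -- is cancelled.
  falling-scaled-bound : ∀ q n → 15 * (q + 64) ≤ n → n * n * n * n * n * n * q ≤ falling n 6 * (q + 64)
  falling-scaled-bound q n n≥ = ℕP.+-cancelʳ-≤ (64 * (p * n)) _ _ (begin
    p * n * q + 64 * (p * n)                      ≡⟨ regroup₁ p n q ⟩
    p * n * (q + 64)                              ≤⟨ ℕP.*-monoˡ-≤ (q + 64) (falling-bound n 5≤n) ⟩
    (falling n 6 + 15 * p) * (q + 64)             ≡⟨ regroup₂ p (falling n 6) q ⟩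
    falling n 6 * (q + 64) + p * (15 * (q + 64))  ≤⟨ ℕP.+-monoʳ-≤ (falling n 6 * (q + 64)) (ℕP.*-monoʳ-≤ p n≥) ⟩
    falling n 6 * (q + 64) + p * n                ≤⟨ ℕP.+-monoʳ-≤ (falling n 6 * (q + 64)) (ℕP.m≤n*m (p * n) 64) ⟩
    falling n 6 * (q + 64) + 64 * (p * n)         ∎)
    where
    open ℕP.≤-Reasoning
    p = n * n * n * n * n
    5≤n : 5 ≤ n
    -- 5 + 955 = 960 = 15 * 64.
    5≤n = ℕP.≤-trans (ℕP.m≤m+n 5 955) (ℕP.≤-trans (ℕP.*-monoʳ-≤ 15 (ℕP.m≤n+m 64 q)) n≥)
    regroup₁ : ∀ p n q → p * n * q + 64 * (p * n) ≡ p * n * (q + 64)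
    regroup₁ = ℕSolver.solve-∀
    regroup₂ : ∀ p m q → (m + 15 * p) * (q + 64) ≡ m * (q + 64) + p * (15 * (q + 64))
    regroup₂ = ℕSolver.solve-∀

  -- The cross-multiplied form of h/m ≤ 1/64 + (p + 1)/q. The middle of the chain proves it with 1/q
  -- in place of (p + 1)/q, and `p * 64 * m` makes up the difference.
  cross-multiplied : ∀ h m r q → 64 * h ≤ r → r * q ≤ m * (q + 64) → ∀ p → h * (64 * q) ≤ (1 * q + ℕ.suc p * 64) * m
  cross-multiplied h m r q 64h≤r rq≤ p = begin
    h * (64 * q)                ≡⟨ regroup₁ h q ⟩
    64 * h * q                  ≤⟨ ℕP.*-monoˡ-≤ q 64h≤r ⟩
    r * q                       ≤⟨ rq≤ ⟩
    m * (q + 64)                ≤⟨ ℕP.m≤m+n _ (p * 64 * m) ⟩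
    m * (q + 64) + p * 64 * m   ≡⟨ regroup₂ m q p ⟩
    (1 * q + ℕ.suc p * 64) * m  ∎
    where
    open ℕP.≤-Reasoning
    regroup₁ : ∀ h q → h * (64 * q) ≡ 64 * h * q
    regroup₁ = ℕSolver.solve-∀
    regroup₂ : ∀ m q p → m * (q + 64) + p * 64 * m ≡ (1 * q + (1 + p) * 64) * m
    regroup₂ = ℕSolver.solve-∀

-- Passage to rational numbers.

open import Data.Rational using (ℚ; _<_; _≤_; _+_; 0ℚ; 1ℚ; _/_)

-- On unnormalised rationals the order is cross-multiplication by definition, so the hypothesis
-- applies there and the result is carried back.
ratio-bound : ∀ h m p q .(c : Coprime (ℕ.suc p) (ℕ.suc q)) → h ℕ.* (64 ℕ.* ℕ.suc q) ℕ.≤ (1 ℕ.* ℕ.suc q ℕ.+ ℕ.suc p ℕ.* 64) ℕ.* ℕ.suc m →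
  (+ h) / ℕ.suc m ≤ (+ 1) / 64 + mkℚ (+ ℕ.suc p) q c
ratio-bound h m p q c le = ℚP.toℚᵘ-cancel-≤ (begin
  toℚᵘ ((+ h) / ℕ.suc m)                            ≃⟨ ℚP.toℚᵘ-fromℚᵘ (mkℚᵘ (+ h) m) ⟩
  mkℚᵘ (+ h) m                                      ≤⟨ ℚᵘ.*≤* (subst₂ ℤB._≤_ (ℤP.pos-* h _) (ℤP.pos-* (1 ℕ.* ℕ.suc q ℕ.+ ℕ.suc p ℕ.* 64) (ℕ.suc m)) (+≤+ le)) ⟩
  -- Denominators are stored minus one, so 63 stands for 64 and `q` for the denominator `ℕ.suc q`.
  mkℚᵘ (+ 1) 63 ℚᵘ.+ mkℚᵘ (+ ℕ.suc p) q             ≃⟨ ℚᵘP.≃-sym (ℚP.toℚᵘ-homo-+ ((+ 1) / 64) (mkℚ (+ ℕ.suc p) q c)) ⟩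
  toℚᵘ ((+ 1) / 64 + mkℚ (+ ℕ.suc p) q c)           ∎)
  where open ℚᵘP.≤-Reasoning

-- For n = 6 + m the falling factorial reduces to a successor, so tinj unfolds without abstracting over it.
tinj-unfold : ∀ m (G : ECGraph (6 ℕ.+ m)) →
  ∃ λ k → falling (6 ℕ.+ m) 6 ≡ ℕ.suc k × tinj G ≡ (+ homInj G) / ℕ.suc k
tinj-unfold m G = _ , refl , refl

tinj-bound : ∀ {n} (G : ECGraph n) p q .(c : Coprime (ℕ.suc p) (ℕ.suc q)) m → 6 ℕ.+ m ≡ n →
  15 ℕ.* (ℕ.suc q ℕ.+ 64) ℕ.≤ n → tinj G ≤ (+ 1) / 64 + mkℚ (+ ℕ.suc p) q c
tinj-bound {n} G p q c m refl n≥n₀ = bound (tinj-unfold m G)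
  where
  bound : (∃ λ k → falling n 6 ≡ ℕ.suc k × tinj G ≡ (+ homInj G) / ℕ.suc k) →
    tinj G ≤ (+ 1) / 64 + mkℚ (+ ℕ.suc p) q c
  bound (k , falling≡ , tinj≡) = subst (_≤ (+ 1) / 64 + mkℚ (+ ℕ.suc p) q c) (≡.sym tinj≡)
    (ratio-bound (homInj G) k p q c (cross-multiplied (homInj G) (ℕ.suc k) (n ℕ.* n ℕ.* n ℕ.* n ℕ.* n ℕ.* n) (ℕ.suc q)
      (homInj-bound G) (subst (λ m → n ℕ.* n ℕ.* n ℕ.* n ℕ.* n ℕ.* n ℕ.* ℕ.suc q ℕ.≤ m ℕ.* (ℕ.suc q ℕ.+ 64)) falling≡
        (falling-scaled-bound (ℕ.suc q) n n≥n₀)) p))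

theorem2 : (ε : ℚ) → 0ℚ < ε →
    Σ ℕ (λ n₀ → (n : ℕ) → n ≥ n₀ → (G : ECGraph n) →
    tinj G ≤ (+ 1) / 64 + ε)
theorem2 (mkℚ (+ ℕ.zero) _ _) (*<* (+<+ ()))
theorem2 (mkℚ -[1+ _ ] _ _) (*<* ())
-- The threshold is 15 (denominator of ε + 64), as `falling-scaled-bound` demands.
theorem2 (mkℚ (+ ℕ.suc p) q c) _ = 15 ℕ.* (ℕ.suc q ℕ.+ 64) , λ n n≥n₀ G →
  -- 6 + 954 = 15 * 64, so the threshold also guarantees n ≥ 6.
  let m , 6+m≡n = ℕP.m≤n⇒∃[o]m+o≡n (ℕP.≤-trans (ℕP.≤-trans (ℕP.m≤m+n 6 954) (ℕP.*-monoʳ-≤ 15 (ℕP.m≤n+m 64 (ℕ.suc q)))) n≥n₀)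
  in tinj-bound G p q c m 6+m≡n n≥n₀
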